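{- Let $\alpha,\beta$ be parameters and $q$ an indeterminate, and let $E_{n,k}(\alpha,\beta,q)$ ($n\ge k\ge 0$) be the numbers defined in the context. For all integers $n\geq k\geq 0$, \[ E_{n,k}(\alpha,\beta,q)=\sum_{\sigma\in\mathfrak{S}_{n+1,k}}[\alpha]^{\mathrm{lrmin}(\sigma)-1}[\beta]^{\mathrm{rlmin}(\sigma)-1}q^{\widetilde{\mathrm{maj}}(\sigma)}, \] where $\mathfrak{S}_{n+1,k}$ is the set of permutations of $\{1,\dots,n+1\}$ with exactly $k$ descents and, for $\sigma\in\mathfrak{S}_{n+1}$, \[ \widetilde{\mathrm{maj}}(\sigma)=(1+\mathrm{des}(\sigma)-\mathrm{lrmin}(\sigma))(\alpha-1)+(n+1-\mathrm{rlmin}(\sigma))(\beta-1)+\mathrm{maj}(\sigma). \]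
   Context: For a real $x$, $[x]=\frac{1-q^x}{1-q}$. The numbers $E_{n,k}(\alpha,\beta,q)$ (in the paper, $E_{n,k}(\alpha,\beta,q)=A(k,n-k\,|\,\alpha,\beta)_q$, Gaudin's $q$-analogue of the Carlitz–Scoville numbers obtained by normalizing Nadeau–Tewari remixed Eulerian numbers) are determined by $E_{0,0}=1$, $E_{n,k}=0$ if $k\notin\{0,\dots,n\}$, and for $n\ge1$ \[ E_{n,k}(\alpha,\beta,q)=q^{\beta+k-1}[n-k+\alpha]E_{n-1,k-1}(\alpha,\beta,q)+[k+\beta]E_{n-1,k}(\alpha,\beta,q). \] For $\sigma=\sigma_1\cdots\sigma_m\in\mathfrak{S}_m$: $\mathrm{des}(\sigma)=|\{i\in[m-1]:\sigma_i>\sigma_{i+1}\}|$; $\mathrm{maj}(\sigma)=\sum_{\sigma_i>\sigma_{i+1}}i$; $\mathrm{lrmin}(\sigma)=|\{i:\sigma_i<\sigma_j\ \forall j<i\}|$ (left-to-right minima); $\mathrm{rlmin}(\sigma)=|\{i:\sigma_i<\sigma_j\ \forall j>i\}|$ (right-to-left minima). -}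

module Defs where

open import Algebra.Bundles using (CommutativeRing)
open import Algebra.Morphism.Structures using (module MonoidMorphisms)
import Algebra.Properties.Semiring.Exp as SemiringExp
import Algebra.Properties.Semiring.Mult as SemiringMult
import Relation.Binary.Reasoning.Setoid as SetoidReasoning
open import Data.Fin.Base using (Fin; zero; suc; toℕ; inject₁; _<_)
open import Data.Fin.Properties using (_≟_; _<?_; all?)
open import Data.List.Base using (List; []; _∷_; map; filter; foldr; length; allFin; cartesianProductWith)
open import Data.List.Membership.Propositional using (_∈_)
open import Data.List.Membership.Propositional.Properties
  using (∈-allFin; ∈-cartesianProductWith⁺; ∈-filter⁺; ∈-filter⁻)
import Data.List.Relation.Unary.All as ListAll
import Data.List.Relation.Unary.AllPairs as ListPairs
import Data.List.Relation.Unary.Unique.Propositional as ListUnique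
import Data.List.Relation.Unary.Unique.Propositional.Properties as ListUniqueₚ
open import Data.List.Relation.Unary.Any using (here)
open import Data.Nat.Base as ℕ using (ℕ; zero; suc)
open import Data.Nat.ListAction using (sum)
import Data.Nat.Properties as ℕₚ
open import Data.Product.Base using (_×_; _,_)
open import Data.Vec.Base as Vec using (Vec; lookup)
open import Data.Vec.Properties using (∷-injective)
open import Data.Vec.Relation.Unary.AllPairs using (allPairs?)
open import Data.Vec.Relation.Unary.Unique.Propositional using (Unique)
open import Level using (Level; _⊔_)
open import Relation.Binary.PropositionalEquality using (_≡_; refl)
open import Relation.Nullary.Decidable using (Dec; ¬?; _→-dec_)

-- A permutation σ of {1,…,m} is its one-line word σ₁⋯σₘ, a duplicate-free
-- vector in Vec (Fin m) m.  Letters and positions are numbered from 0; this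
-- matters only for maj, where the position is shifted back.

words : (r m : ℕ) → List (Vec (Fin r) m)
words r zero    = Vec.[] ∷ []
words r (suc m) = cartesianProductWith Vec._∷_ (allFin r) (words r m)

unique? : ∀ {r m} (σ : Vec (Fin r) m) → Dec (Unique σ)
unique? = allPairs? (λ a b → ¬? (a ≟ b))

permutations : (m : ℕ) → List (Vec (Fin m) m)
permutations m = filter unique? (words m m)

module _ {r m : ℕ} (σ : Vec (Fin r) (suc m)) where

  descents : List (Fin m)
  descents = filter (λ i → lookup σ (suc i) <? lookup σ (inject₁ i)) (allFin m)

  des : ℕ
  des = length descents

  maj : ℕ
  maj = sum (map (λ i → suc (toℕ i)) descents)

  lrmin : ℕ
  lrmin = length (filter
    (λ i → all? (λ j → (j <? i) →-dec (lookup σ i <? lookup σ j)))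
    (allFin (suc m)))

  rlmin : ℕ
  rlmin = length (filter
    (λ i → all? (λ j → (i <? j) →-dec (lookup σ i <? lookup σ j)))
    (allFin (suc m)))

𝔖 : (n k : ℕ) → List (Vec (Fin (suc n)) (suc n))
𝔖 n k = filter (λ σ → des σ ℕₚ.≟ k) (permutations (suc n))

-- 𝔖 n k lists each permutation of n + 1 letters with k descents exactly once.

∈-words : ∀ {r m} (σ : Vec (Fin r) m) → σ ∈ words r m
∈-words Vec.[]      = here refl
∈-words (a Vec.∷ σ) = ∈-cartesianProductWith⁺ Vec._∷_ (∈-allFin a) (∈-words σ)

words-unique : ∀ r m → ListUnique.Unique (words r m)
words-unique r zero    = ListAll.[] ListPairs.∷ ListPairs.[]
words-unique r (suc m) =
  ListUniqueₚ.cartesianProductWith⁺ Vec._∷_ ∷-injective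
    (ListUniqueₚ.allFin⁺ r) (words-unique r m)

∈-𝔖⁺ : ∀ {n k} {σ : Vec (Fin (suc n)) (suc n)} → Unique σ → des σ ≡ k → σ ∈ 𝔖 n k
∈-𝔖⁺ {σ = σ} u d = ∈-filter⁺ _ (∈-filter⁺ unique? (∈-words σ) u) d

∈-𝔖⁻ : ∀ {n k} {σ : Vec (Fin (suc n)) (suc n)} → σ ∈ 𝔖 n k → Unique σ × des σ ≡ k
∈-𝔖⁻ {n} {k} σ∈ with ∈-filter⁻ (λ σ → des σ ℕₚ.≟ k) {xs = permutations (suc n)} σ∈
... | σ∈perm , d with ∈-filter⁻ unique? {xs = words (suc n) (suc n)} σ∈perm
... | _ , u = u , d

𝔖-unique : ∀ n k → ListUnique.Unique (𝔖 n k)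
𝔖-unique n k = ListUniqueₚ.filter⁺ _ (ListUniqueₚ.filter⁺ unique? (words-unique (suc n) (suc n)))

-- The setting in which qˣ and [x] = (1 - qˣ)/(1 - q) make sense: exponents x
-- range over a commutative ring X, values lie in a commutative ring K, and
-- x ↦ qˣ satisfies q⁰ = 1 and qˣ⁺ʸ = qˣ qʸ, with 1 - q invertible.  Instances
-- are X = ℝ with a real q > 0, q ≠ 1, and X = ℤ[α,β] with q, q^α, q^β
-- independent indeterminates.

record QPower {x ℓx c ℓ : Level} (X : CommutativeRing x ℓx) (K : CommutativeRing c ℓ)
       : Set (x ⊔ ℓx ⊔ c ⊔ ℓ) where

  private
    module X = CommutativeRing X
  open CommutativeRing K
  open MonoidMorphisms X.+-rawMonoid *-rawMonoid using (IsMonoidHomomorphism)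

  field
    q^_                  : X.Carrier → Carrier
    isMonoidHomomorphism : IsMonoidHomomorphism q^_

  q : Carrier
  q = q^ X.1#

  field
    [1-q]⁻¹   : Carrier
    [1-q]-inv : (1# - q) * [1-q]⁻¹ ≈ 1#

  infix 9 q^_

  [_] : X.Carrier → Carrier
  [ x ] = (1# - q^ x) * [1-q]⁻¹

  ι : ℕ → X.Carrier
  ι n = n ×ₓ X.1#
    where open SemiringMult X.semiring renaming (_×_ to _×ₓ_)

  infixr 8 _^_
  _^_ : Carrier → ℕ → Carrier
  _^_ = SemiringExp._^_ semiring

  ∑ : ∀ {a} {A : Set a} → List A → (A → Carrier) → Carrier
  ∑ xs f = foldr _+_ 0# (map f xs)

  module _ (α β : X.Carrier) where

    -- In the row k = 0 the summand of the recurrence containing E_{n-1,-1} = 0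
    -- is dropped; E-vanish gives the other boundary condition.
    E : ℕ → ℕ → Carrier
    E zero    zero    = 1#
    E zero    (suc k) = 0#
    E (suc n) zero    = [ ι 0 X.+ β ] * E n 0
    E (suc n) (suc k) =
      q^ (β X.+ ι (suc k) X.- X.1#) * [ ι (suc n) X.- ι (suc k) X.+ α ] * E n k
      + [ ι (suc k) X.+ β ] * E n (suc k)

    E-vanish : ∀ n k → n ℕ.< k → E n k ≈ 0#
    E-vanish zero    (suc k) _   = CommutativeRing.refl K
    E-vanish (suc n) (suc k) n<k = begin
      _ * E n k + _ * E n (suc k) ≈⟨ +-cong (*-congˡ (E-vanish n k (ℕ.s<s⁻¹ n<k)))
                                            (*-congˡ (E-vanish n (suc k) (ℕₚ.m<n⇒m<1+n (ℕ.s<s⁻¹ n<k)))) ⟩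
      _ * 0# + _ * 0#             ≈⟨ +-cong (zeroʳ _) (zeroʳ _) ⟩
      0# + 0#                     ≈⟨ +-identityˡ 0# ⟩
      0#                          ∎
      where open SetoidReasoning setoid

    -- The differences are taken in X, so nothing is truncated.
    maj~ : ∀ {n} → Vec (Fin (suc n)) (suc n) → X.Carrier
    maj~ {n} σ =
      (X.1# X.+ ι (des σ) X.- ι (lrmin σ)) X.* (α X.- X.1#)
      X.+ (ι (suc n) X.- ι (rlmin σ)) X.* (β X.- X.1#)
      X.+ ι (maj σ)

{-# OPTIONS --safe #-}
module Submission where

-- Both sides satisfy the recurrence defining E: delete the largest letter.
-- Let τ have n letters, d descents and a = n − 1 − d ascents, and insert a new
-- largest letter.  At the end it contributes a factor [β]; in the descents, the
-- factors q^β, q^(β+1), …, q^(β+d−1); together these add up to [d + β].  At the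
-- front it contributes q^(β+d) [α]; in the ascents, q^(β+d) times q^α, …,
-- q^(α+a−1); together these add up to q^(β+d) [a + α].

open import Defs
open import Algebra.Bundles using (CommutativeMonoid; CommutativeRing)
open import Algebra.Morphism.Structures using (module MonoidMorphisms)
import Algebra.Properties.AbelianGroup as AbelianGroupProperties
import Algebra.Properties.CommutativeMonoid.Sum as MonoidSum
import Algebra.Properties.Ring as RingProperties
import Algebra.Properties.Semiring.Mult as SemiringMult
import Algebra.Properties.Semiring.Sum as SemiringSum
import Algebra.Solver.Ring.NaturalCoefficients.Default as NaturalSolver
open import Data.Bool.Base using (true; false; if_then_else_)
open import Data.Fin.Base using (Fin; zero; suc; toℕ; fromℕ; inject₁; punchIn; punchOut; _<_)
open import Data.Fin.Properties using (_≟_; _<?_; all?; any?; ≤fromℕ; ≤∧≢⇒<; <⇒≢; injective⇒≤; punchIn-injective; punchInᵢ≢i; punchIn-mono-≤; punchIn-cancel-≤; punchIn-punchOut; punchOut-injective; toℕ-fromℕ; toℕ-inject₁; toℕ<n)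
open import Data.List.Base as List using (List; []; _∷_; _++_; map; filter; length; allFin; cartesianProductWith)
open import Data.List.Membership.Propositional using (_∈_; lose)
open import Data.List.Membership.Propositional.Properties using (∈-allFin; ∈-cartesianProductWith⁺; ∈-cartesianProductWith⁻; ∈-filter⁺; ∈-filter⁻)
open import Data.List.Membership.Propositional.Properties.WithK using (unique∧set⇒bag)
open import Data.List.Properties using (filter-some)
open import Data.List.Relation.Binary.BagAndSetEquality using (∼bag⇒↭)
open import Data.List.Relation.Binary.Permutation.Propositional using (_↭_)
import Data.List.Relation.Unary.Unique.Propositional as ListUnique
import Data.List.Relation.Unary.Unique.Propositional.Properties as ListUniqueₚ
open import Data.Nat.Base as ℕ using (ℕ; zero; suc; _≤_; _∸_)
import Data.Nat.ListAction as ℕ-List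
import Data.Nat.Properties as ℕₚ
open import Data.Nat.Solver using (module +-*-Solver)
open import Data.Product.Base using (_×_; _,_; ∃; ∃₂; proj₂)
open import Data.Vec.Base as Vec using (Vec; lookup; insertAt)
open import Data.Vec.Properties using (insertAt-lookup; insertAt-punchIn; lookup-map; lookup∘tabulate; tabulate∘lookup)
open import Data.Vec.Relation.Binary.Pointwise.Extensional using (ext; Pointwise-≡⇒≡)
open import Data.Vec.Relation.Unary.Unique.Propositional using (Unique)
import Data.Vec.Relation.Unary.Unique.Propositional.Properties as VecUniqueₚ
open import Function.Base using (_∘_; flip; id)
open import Function.Bundles using (_⇔_; mk⇔; Equivalence)
open import Relation.Binary.Definitions using (Decidable)
open import Relation.Binary.PropositionalEquality as ≡ using (_≡_; _≢_; _≗_)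
import Relation.Binary.Reasoning.Setoid as SetoidReasoning
open import Relation.Nullary.Decidable using (Dec; yes; no; does; ¬?; _→-dec_; does-⇔; dec-true; dec-false)
open import Relation.Nullary.Negation using (¬_; contradiction)
open import Relation.Unary using (Pred) renaming (Decidable to Decidable₁)

-- The correction terms in `maj~` are what produce these factors. An insertion at the front raises
-- `des` and `lrmin` together, one at the end or in a descent raises neither, so `1 + des - lrmin`
-- grows only in an ascent, by one, and supplies q^(α-1). The difference of length and `rlmin` stays
-- fixed only at the end, so every other slot supplies q^(β-1). Plain `maj` adds the rest: 0 at the
-- end, 1, ..., d in the descents, d + 1 at the front, d + 2, ..., n in the ascents. Front and
-- ascents create a descent, end and descents do not. Hence words with k descents come from τ with k
-- - 1 or k descents, one term of the recurrence for each. The sum over the slots of either kind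
-- depends on τ, apart from its weight, only through d, so it can be taken out of the sum over τ.

module ℕΣ = MonoidSum ℕₚ.+-0-commutativeMonoid

-- Counting by sums of indicators.

indicator : ∀ {p} {P : Set p} → Dec P → ℕ
indicator P? = if does P? then 1 else 0

module _ {p} {P : Set p} (P? : Dec P) where

  indicator-true : P → indicator P? ≡ 1
  indicator-true = ≡.cong (λ b → if b then 1 else 0) ∘ dec-true P?

  indicator-false : ¬ P → indicator P? ≡ 0
  indicator-false = ≡.cong (λ b → if b then 1 else 0) ∘ dec-false P?

indicator-⇔ : ∀ {p q} {P : Set p} {Q : Set q} → P ⇔ Q → (P? : Dec P) (Q? : Dec Q) →
              indicator P? ≡ indicator Q?
indicator-⇔ P⇔Q P? Q? = ≡.cong (λ b → if b then 1 else 0) (does-⇔ P⇔Q P? Q?)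

module _ {a p} {A : Set a} {P : Pred A p} (P? : Decidable₁ P) where

  sum-filter-tabulate : ∀ {n} (h : A → ℕ) (g : Fin n → A) →
    ℕ-List.sum (map h (filter P? (List.tabulate g))) ≡ ℕΣ.sum (λ i → indicator (P? (g i)) ℕ.* h (g i))
  sum-filter-tabulate {zero}  h g = ≡.refl
  sum-filter-tabulate {suc n} h g with ih ← sum-filter-tabulate h (g ∘ suc) | P? (g zero)
  ... | yes _ = ≡.cong₂ ℕ._+_ (≡.sym (ℕₚ.*-identityˡ _)) ih
  ... | no  _ = ih

  length-filter-tabulate : ∀ {n} (g : Fin n → A) →
    length (filter P? (List.tabulate g)) ≡ ℕΣ.sum (λ i → indicator (P? (g i)))
  length-filter-tabulate {zero}  g = ≡.refl
  length-filter-tabulate {suc n} g with ih ← length-filter-tabulate (g ∘ suc) | P? (g zero)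
  ... | yes _ = ≡.cong suc ih
  ... | no  _ = ih

-- Inserting a largest letter into a word.

punchIn-mono-< : ∀ {n} p {i j : Fin n} → i < j → punchIn p i < punchIn p j
punchIn-mono-< p i<j = ≤∧≢⇒< (punchIn-mono-≤ p _ _ (ℕₚ.<⇒≤ i<j)) (<⇒≢ i<j ∘ punchIn-injective p _ _)

punchIn-cancel-< : ∀ {n} p {i j : Fin n} → punchIn p i < punchIn p j → i < j
punchIn-cancel-< p {i} {j} pi<pj =
  ≤∧≢⇒< (punchIn-cancel-≤ p _ _ (ℕₚ.<⇒≤ pi<pj)) (<⇒≢ pi<pj ∘ ≡.cong (punchIn p))

punchIn-<-⇔ : ∀ {n} p {i j : Fin n} → (punchIn p i < punchIn p j) ⇔ (i < j)
punchIn-<-⇔ p = mk⇔ (punchIn-cancel-< p) (punchIn-mono-< p)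

-- Has the values of `inject₁`, but in the form `punchIn` the same order lemmas serve letters and
-- positions, and `punchOut` undoes it.
raise : ∀ {r} → Fin r → Fin (suc r)
raise {r} = punchIn (fromℕ r)

raise<top : ∀ {r} (a : Fin r) → raise a < fromℕ r
raise<top a = ≤∧≢⇒< (≤fromℕ _) (punchInᵢ≢i _ a)

insertTop : ∀ {r m} → Vec (Fin r) m → Fin (suc m) → Vec (Fin (suc r)) (suc m)
insertTop {r} σ p = insertAt (Vec.map raise σ) p (fromℕ r)

module _ {r m} (σ : Vec (Fin r) m) (p : Fin (suc m)) where

  lookup-insertTop : lookup (insertTop σ p) p ≡ fromℕ r
  lookup-insertTop = insertAt-lookup (Vec.map raise σ) p (fromℕ r)

  lookup-insertTop-punchIn : ∀ i → lookup (insertTop σ p) (punchIn p i) ≡ raise (lookup σ i)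
  lookup-insertTop-punchIn i =
    ≡.trans (insertAt-punchIn (Vec.map raise σ) p (fromℕ r) i) (lookup-map i raise σ)

-- Matching on this view brings a position into a form on which `lookup-insertTop` or
-- `lookup-insertTop-punchIn` rewrites.
data SlotView {m} (p : Fin (suc m)) : Fin (suc m) → Set where
  at   : SlotView p p
  away : ∀ i → SlotView p (punchIn p i)

slotView : ∀ {m} (p j : Fin (suc m)) → SlotView p j
slotView p j with p ≟ j
... | yes ≡.refl = at
... | no  p≢j  = ≡.subst (SlotView p) (punchIn-punchOut p≢j) (away (punchOut p≢j))

-- Left-to-right minima are the case i R j = i < j, right-to-left minima the
-- case i R j = j < i.

module Minima
  (_R_ : ∀ {n} → Fin n → Fin n → Set)
  (_R?_ : ∀ {n} → Decidable (_R_ {n}))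
  (punchIn-R : ∀ {n} p {i j : Fin n} → (punchIn p i R punchIn p j) ⇔ (i R j))
  where

  IsMinimum : ∀ {r m} → Vec (Fin r) m → Fin m → Set
  IsMinimum σ i = ∀ j → j R i → lookup σ i < lookup σ j

  isMinimum? : ∀ {r m} (σ : Vec (Fin r) m) → Decidable₁ (IsMinimum σ)
  isMinimum? σ i = all? (λ j → (j R? i) →-dec (lookup σ i <? lookup σ j))

  minima : ∀ {r m} → Vec (Fin r) m → ℕ
  minima {m = m} σ = length (filter (isMinimum? σ) (allFin m))

  minima-positive : ∀ {r m} (σ : Vec (Fin r) m) {i} → (∀ j → ¬ (j R i)) → 0 ℕ.< minima σ
  minima-positive σ {i} ¬R = filter-some (isMinimum? σ) (lose (∈-allFin i) (λ j jRi → contradiction jRi (¬R j)))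

  module _ {r m} (σ : Vec (Fin r) m) (p : Fin (suc m)) where

    -- No letter exceeds the new one, so the condition at `p` can hold only vacuously.
    insertTop-at : IsMinimum (insertTop σ p) p ⇔ (∀ j → ¬ (j R p))
    insertTop-at = mk⇔
      (λ min j jRp → ℕₚ.<⇒≱ (≡.subst (_< lookup (insertTop σ p) j) (lookup-insertTop σ p) (min j jRp)) (≤fromℕ (lookup (insertTop σ p) j)))
      (λ ¬R j jRp → contradiction jRp (¬R j))

    -- `raise` and `punchIn p` preserve and reflect the order, and comparison with the new letter
    -- always succeeds because it is the largest.
    insertTop-away : ∀ i → IsMinimum (insertTop σ p) (punchIn p i) ⇔ IsMinimum σ i
    insertTop-away i = mk⇔ to from
      where
      to : IsMinimum (insertTop σ p) (punchIn p i) → IsMinimum σ i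
      to min j jRi = punchIn-cancel-< (fromℕ r)
        (≡.subst₂ _<_ (lookup-insertTop-punchIn σ p i) (lookup-insertTop-punchIn σ p j)
          (min (punchIn p j) (Equivalence.from (punchIn-R p) jRi)))

      from : IsMinimum σ i → IsMinimum (insertTop σ p) (punchIn p i)
      from min j jRi rewrite lookup-insertTop-punchIn σ p i with slotView p j
      ... | at rewrite lookup-insertTop σ p = raise<top (lookup σ i)
      ... | away j′ rewrite lookup-insertTop-punchIn σ p j′ =
        punchIn-mono-< (fromℕ r) (min j′ (Equivalence.to (punchIn-R p) jRi))

    minima-insertTop : minima (insertTop σ p) ≡ indicator (all? (λ j → ¬? (j R? p))) ℕ.+ minima σ
    minima-insertTop = begin
      minima (insertTop σ p)
        ≡⟨ length-filter-tabulate (isMinimum? (insertTop σ p)) (λ i → i) ⟩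
      ℕΣ.sum (λ i → indicator (isMinimum? (insertTop σ p) i))
        ≡⟨ ℕΣ.sum-remove {i = p} (λ i → indicator (isMinimum? (insertTop σ p) i)) ⟩
      indicator (isMinimum? (insertTop σ p) p) ℕ.+
      ℕΣ.sum (λ i → indicator (isMinimum? (insertTop σ p) (punchIn p i)))
        ≡⟨ ≡.cong₂ ℕ._+_ (indicator-⇔ insertTop-at (isMinimum? (insertTop σ p) p) (all? (λ j → ¬? (j R? p))))
                     (ℕΣ.sum-cong-≗ (λ i → indicator-⇔ (insertTop-away i) (isMinimum? (insertTop σ p) (punchIn p i)) (isMinimum? σ i))) ⟩
      indicator (all? (λ j → ¬? (j R? p))) ℕ.+ ℕΣ.sum (λ i → indicator (isMinimum? σ i))
        ≡⟨ ≡.cong (indicator (all? (λ j → ¬? (j R? p))) ℕ.+_) (length-filter-tabulate (isMinimum? σ) (λ i → i)) ⟨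
      indicator (all? (λ j → ¬? (j R? p))) ℕ.+ minima σ
        ∎
      where open ≡.≡-Reasoning

    minima-insertTop-new : (∀ j → ¬ (j R p)) → minima (insertTop σ p) ≡ suc (minima σ)
    minima-insertTop-new ¬R = ≡.trans minima-insertTop (≡.cong (ℕ._+ minima σ) (indicator-true (all? (λ j → ¬? (j R? p))) ¬R))

    minima-insertTop-old : ∀ j → j R p → minima (insertTop σ p) ≡ minima σ
    minima-insertTop-old j jRp =
      ≡.trans minima-insertTop (≡.cong (ℕ._+ minima σ) (indicator-false (all? (λ j → ¬? (j R? p))) (λ ¬R → ¬R j jRp)))

-- `lrmin` and `rlmin` unfold to `LR.minima` and `RL.minima`, so the lemmas above apply to them
-- without conversion. The eta-expansion in `RL` lets the implicit positions be instantiated in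
-- swapped order.
module LR = Minima _<_ _<?_ punchIn-<-⇔
module RL = Minima (flip _<_) (flip _<?_) (λ p → punchIn-<-⇔ p)

≮top : ∀ {m} (j : Fin (suc m)) → ¬ (fromℕ m < j)
≮top j top<j = ℕₚ.<⇒≱ top<j (≤fromℕ j)

inject₁<top : ∀ {m} (i : Fin m) → inject₁ i < fromℕ m
inject₁<top {m} i = ≡.subst₂ ℕ._<_ (≡.sym (toℕ-inject₁ i)) (≡.sym (toℕ-fromℕ m)) (toℕ<n i)

module _ {r m} (σ : Vec (Fin r) (suc m)) where

  lrmin-positive : 0 ℕ.< lrmin σ
  lrmin-positive = LR.minima-positive σ {zero} (λ _ ())

  rlmin-positive : 0 ℕ.< rlmin σ
  rlmin-positive = RL.minima-positive σ {fromℕ m} ≮top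

  lrmin-insertTop-zero : lrmin (insertTop σ zero) ≡ suc (lrmin σ)
  lrmin-insertTop-zero = LR.minima-insertTop-new σ zero (λ _ ())

  lrmin-insertTop-suc : ∀ p → lrmin (insertTop σ (suc p)) ≡ lrmin σ
  lrmin-insertTop-suc p = LR.minima-insertTop-old σ (suc p) zero ℕ.z<s

  rlmin-insertTop-top : rlmin (insertTop σ (fromℕ (suc m))) ≡ suc (rlmin σ)
  rlmin-insertTop-top = RL.minima-insertTop-new σ (fromℕ (suc m)) ≮top

  rlmin-insertTop-inject₁ : ∀ p → rlmin (insertTop σ (inject₁ p)) ≡ rlmin σ
  rlmin-insertTop-inject₁ p = RL.minima-insertTop-old σ (inject₁ p) (fromℕ (suc m)) (inject₁<top p)

-- Descents, ascents and the major index under insertion.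

module _ {r m} (σ : Vec (Fin r) (suc m)) where

  private
    descent? : (i : Fin m) → Dec (lookup σ (suc i) < lookup σ (inject₁ i))
    descent? i = lookup σ (suc i) <? lookup σ (inject₁ i)

  des-sum : des σ ≡ ℕΣ.sum (λ i → indicator (descent? i))
  des-sum = length-filter-tabulate descent? (λ i → i)

  maj-sum : maj σ ≡ ℕΣ.sum (λ i → indicator (descent? i) ℕ.* suc (toℕ i))
  maj-sum = sum-filter-tabulate descent? (suc ∘ toℕ) (λ i → i)

module _ {r m} (a b : Fin r) (v : Vec (Fin r) m) where

  open ≡.≡-Reasoning

  des-∷ : des (a Vec.∷ b Vec.∷ v) ≡ indicator (b <? a) ℕ.+ des (b Vec.∷ v)
  des-∷ = ≡.trans (des-sum (a Vec.∷ b Vec.∷ v)) (≡.cong (_ ℕ.+_) (≡.sym (des-sum (b Vec.∷ v))))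

  -- Prepending a letter moves each descent of the tail one position to the right, which adds `des`
  -- of the tail; a new descent stands at position 1.
  maj-∷ : maj (a Vec.∷ b Vec.∷ v) ≡ indicator (b <? a) ℕ.+ (des (b Vec.∷ v) ℕ.+ maj (b Vec.∷ v))
  maj-∷ = begin
    maj (a Vec.∷ b Vec.∷ v)
      ≡⟨ maj-sum (a Vec.∷ b Vec.∷ v) ⟩
    indicator (b <? a) ℕ.* 1 ℕ.+ ℕΣ.sum (λ i → ind i ℕ.* suc (suc (toℕ i)))
      ≡⟨ ≡.cong₂ ℕ._+_ (ℕₚ.*-identityʳ (indicator (b <? a)))
                   (ℕΣ.sum-cong-≗ (λ i → ℕₚ.*-suc (ind i) (suc (toℕ i)))) ⟩
    indicator (b <? a) ℕ.+ ℕΣ.sum (λ i → ind i ℕ.+ ind i ℕ.* suc (toℕ i))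
      ≡⟨ ≡.cong (_ ℕ.+_) (ℕΣ.∑-distrib-+ ind (λ i → ind i ℕ.* suc (toℕ i))) ⟩
    indicator (b <? a) ℕ.+ (ℕΣ.sum ind ℕ.+ ℕΣ.sum (λ i → ind i ℕ.* suc (toℕ i)))
      ≡⟨ ≡.cong (indicator (b <? a) ℕ.+_) (≡.cong₂ ℕ._+_ (des-sum (b Vec.∷ v)) (maj-sum (b Vec.∷ v))) ⟨
    indicator (b <? a) ℕ.+ (des (b Vec.∷ v) ℕ.+ maj (b Vec.∷ v))
      ∎
    where
    ind : Fin m → ℕ
    ind i = indicator (lookup (b Vec.∷ v) (suc i) <? lookup (b Vec.∷ v) (inject₁ i))

indicator-raise : ∀ {r} (a b : Fin r) → indicator (raise b <? raise a) ≡ indicator (b <? a)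
indicator-raise {r} a b = indicator-⇔ (punchIn-<-⇔ (fromℕ r)) (raise b <? raise a) (b <? a)

des-raise : ∀ {r m} (σ : Vec (Fin r) (suc m)) → des (Vec.map raise σ) ≡ des σ
des-raise (a Vec.∷ Vec.[])      = ≡.refl
des-raise (a Vec.∷ b Vec.∷ v)
  rewrite des-∷ (raise a) (raise b) (Vec.map raise v) | des-∷ a b v
        | indicator-raise a b | des-raise (b Vec.∷ v) = ≡.refl

maj-raise : ∀ {r m} (σ : Vec (Fin r) (suc m)) → maj (Vec.map raise σ) ≡ maj σ
maj-raise (a Vec.∷ Vec.[])      = ≡.refl
maj-raise (a Vec.∷ b Vec.∷ v)
  rewrite maj-∷ (raise a) (raise b) (Vec.map raise v) | maj-∷ a b v
        | indicator-raise a b | des-raise (b Vec.∷ v) | maj-raise (b Vec.∷ v) = ≡.refl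

top-descent : ∀ {r} (b : Fin r) → indicator (raise b <? fromℕ r) ≡ 1
top-descent {r} b = indicator-true (raise b <? fromℕ r) (raise<top b)

top-ascent : ∀ {r} (a : Fin r) → indicator (fromℕ r <? raise a) ≡ 0
top-ascent {r} a = indicator-false (fromℕ r <? raise a) (≮top (raise a))

des-insertTop-zero : ∀ {r m} (σ : Vec (Fin r) (suc m)) → des (insertTop σ zero) ≡ suc (des σ)
des-insertTop-zero {r} (a Vec.∷ v)
  rewrite des-∷ (fromℕ r) (raise a) (Vec.map raise v) | top-descent a = ≡.cong suc (des-raise (a Vec.∷ v))

maj-insertTop-zero : ∀ {r m} (σ : Vec (Fin r) (suc m)) → maj (insertTop σ zero) ≡ suc (des σ ℕ.+ maj σ)
maj-insertTop-zero {r} (a Vec.∷ v)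
  rewrite maj-∷ (fromℕ r) (raise a) (Vec.map raise v) | top-descent a =
  ≡.cong suc (≡.cong₂ ℕ._+_ (des-raise (a Vec.∷ v)) (maj-raise (a Vec.∷ v)))

des-insertTop-top : ∀ {r m} (σ : Vec (Fin r) (suc m)) → des (insertTop σ (fromℕ (suc m))) ≡ des σ
des-insertTop-top {r} (a Vec.∷ Vec.[]) rewrite des-∷ (raise a) (fromℕ r) Vec.[] | top-ascent a = ≡.refl
des-insertTop-top (a Vec.∷ b Vec.∷ v)
  rewrite des-∷ (raise a) (raise b) (insertTop v (fromℕ _)) | des-∷ a b v
        | indicator-raise a b | des-insertTop-top (b Vec.∷ v) = ≡.refl

maj-insertTop-top : ∀ {r m} (σ : Vec (Fin r) (suc m)) → maj (insertTop σ (fromℕ (suc m))) ≡ maj σ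
maj-insertTop-top {r} (a Vec.∷ Vec.[]) rewrite maj-∷ (raise a) (fromℕ r) Vec.[] | top-ascent a = ≡.refl
maj-insertTop-top (a Vec.∷ b Vec.∷ v)
  rewrite maj-∷ (raise a) (raise b) (insertTop v (fromℕ _)) | maj-∷ a b v
        | indicator-raise a b | des-insertTop-top (b Vec.∷ v) | maj-insertTop-top (b Vec.∷ v) = ≡.refl

-- Equal neighbours count as ascents, so that `des+asc` holds for words with repeated letters too.
asc : ∀ {r m} → Vec (Fin r) (suc m) → ℕ
asc (a Vec.∷ Vec.[])    = 0
asc (a Vec.∷ b Vec.∷ v) = indicator (¬? (b <? a)) ℕ.+ asc (b Vec.∷ v)

des+asc : ∀ {r m} (σ : Vec (Fin r) (suc m)) → des σ ℕ.+ asc σ ≡ m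
des+asc (a Vec.∷ Vec.[]) = ≡.refl
des+asc (a Vec.∷ b Vec.∷ v) rewrite des-∷ a b v with does (b <? a)
... | true = ≡.cong suc (des+asc (b Vec.∷ v))
... | false = ≡.trans (ℕₚ.+-suc _ _) (≡.cong suc (des+asc (b Vec.∷ v)))

-- Summing over the inner slots.

module _ {c ℓ} (M : CommutativeMonoid c ℓ) where

  open CommutativeMonoid M using (Carrier; _≈_; _∙_; ∙-congˡ; ∙-congʳ; assoc; comm; setoid)
  open MonoidSum M renaming (sum to ∑)
  open SetoidReasoning setoid

  -- An insertion into the descents of σ, read from right to left, raises maj by
  -- 1, …, des σ; an insertion into the ascents, read from left to right, creates
  -- a descent and raises maj by des σ + 2, …, m + 1.

  ∑-insertTop-inner : ∀ {r m} (σ : Vec (Fin r) (suc m)) (f : ℕ → ℕ → Carrier) →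
    ∑ {m} (λ i → f (des (insertTop σ (suc (inject₁ i)))) (maj (insertTop σ (suc (inject₁ i))))) ≈
    ∑ {des σ} (λ j → f (des σ) (suc (toℕ j ℕ.+ maj σ))) ∙
    ∑ {asc σ} (λ j → f (suc (des σ)) (suc (suc (des σ ℕ.+ toℕ j ℕ.+ maj σ))))
  ∑-insertTop-inner (a Vec.∷ Vec.[]) f = CommutativeMonoid.sym M (CommutativeMonoid.identityˡ M _)
  ∑-insertTop-inner {r} (a Vec.∷ b Vec.∷ v) f = begin
    f (des (raise a Vec.∷ fromℕ r Vec.∷ w)) (maj (raise a Vec.∷ fromℕ r Vec.∷ w)) ∙
    ∑ (λ i → f (des (raise a Vec.∷ τ i)) (maj (raise a Vec.∷ τ i)))
      ≡⟨ ≡.cong₂ _∙_ (≡.cong₂ f des-first maj-first) (sum-cong-≗ (λ i → ≡.cong₂ f (des-rest i) (maj-rest i))) ⟩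
    f (suc d) (suc (suc (d ℕ.+ d ℕ.+ M₀))) ∙ ∑ (λ i → f (ε ℕ.+ des (τ i)) (ε ℕ.+ (des (τ i) ℕ.+ maj (τ i))))
      -- Prepending `a` sends (des, maj) to (ε + des, ε + (des + maj)); since `f` is arbitrary, the
      -- induction hypothesis can be taken for `f` composed with this map.
      ≈⟨ ∙-congˡ (∑-insertTop-inner (b Vec.∷ v) (λ x y → f (ε ℕ.+ x) (ε ℕ.+ (x ℕ.+ y)))) ⟩
    f (suc d) (suc (suc (d ℕ.+ d ℕ.+ M₀))) ∙
    (∑ {d} (λ j → f (ε ℕ.+ d) (ε ℕ.+ (d ℕ.+ suc (toℕ j ℕ.+ M₀)))) ∙
     ∑ {k} (λ j → f (ε ℕ.+ suc d) (ε ℕ.+ (suc d ℕ.+ suc (suc (d ℕ.+ toℕ j ℕ.+ M₀))))))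
      ≈⟨ collect ⟩
    ∑ {des σ} (λ j → f (des σ) (suc (toℕ j ℕ.+ maj σ))) ∙
    ∑ {asc σ} (λ j → f (suc (des σ)) (suc (suc (des σ ℕ.+ toℕ j ℕ.+ maj σ))))
      ∎
    where
    σ = a Vec.∷ b Vec.∷ v
    w = Vec.map raise (b Vec.∷ v)
    d = des (b Vec.∷ v)
    M₀ = maj (b Vec.∷ v)
    k = asc (b Vec.∷ v)
    ε = indicator (b <? a)
    τ = λ i → insertTop (b Vec.∷ v) (suc (inject₁ i))

    des-first : des (raise a Vec.∷ fromℕ r Vec.∷ w) ≡ suc d
    des-first rewrite des-∷ (raise a) (fromℕ r) w | top-ascent a = des-insertTop-zero (b Vec.∷ v)

    maj-first : maj (raise a Vec.∷ fromℕ r Vec.∷ w) ≡ suc (suc (d ℕ.+ d ℕ.+ M₀))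
    maj-first rewrite maj-∷ (raise a) (fromℕ r) w | top-ascent a
                    | des-insertTop-zero (b Vec.∷ v) | maj-insertTop-zero (b Vec.∷ v) =
      ≡.cong suc (≡.trans (ℕₚ.+-suc d _) (≡.cong suc (≡.sym (ℕₚ.+-assoc d d M₀))))

    des-rest : ∀ i → des (raise a Vec.∷ τ i) ≡ ε ℕ.+ des (τ i)
    des-rest i = ≡.trans (des-∷ (raise a) (raise b) _) (≡.cong (ℕ._+ des (τ i)) (indicator-raise a b))

    maj-rest : ∀ i → maj (raise a Vec.∷ τ i) ≡ ε ℕ.+ (des (τ i) ℕ.+ maj (τ i))
    maj-rest i = ≡.trans (maj-∷ (raise a) (raise b) _) (≡.cong (ℕ._+ (des (τ i) ℕ.+ maj (τ i))) (indicator-raise a b))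

    open +-*-Solver

    collect : f (suc d) (suc (suc (d ℕ.+ d ℕ.+ M₀))) ∙
      (∑ {d} (λ j → f (ε ℕ.+ d) (ε ℕ.+ (d ℕ.+ suc (toℕ j ℕ.+ M₀)))) ∙
       ∑ {k} (λ j → f (ε ℕ.+ suc d) (ε ℕ.+ (suc d ℕ.+ suc (suc (d ℕ.+ toℕ j ℕ.+ M₀))))))
      ≈
      ∑ {des σ} (λ j → f (des σ) (suc (toℕ j ℕ.+ maj σ))) ∙
      ∑ {asc σ} (λ j → f (suc (des σ)) (suc (suc (des σ ℕ.+ toℕ j ℕ.+ maj σ))))
    collect rewrite des-∷ a b v | maj-∷ a b v with does (b <? a)
    -- The slot between `a` and `b` is a descent, the last one from right to left: its term takes
    -- the index j = d and completes the first sum.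
    ... | true = begin
      f (suc d) (suc (suc (d ℕ.+ d ℕ.+ M₀))) ∙ (A ∙ B)
        ≈⟨ assoc _ _ _ ⟨
      f (suc d) (suc (suc (d ℕ.+ d ℕ.+ M₀))) ∙ A ∙ B
        ≈⟨ ∙-congʳ (comm _ _) ⟩
      A ∙ f (suc d) (suc (suc (d ℕ.+ d ℕ.+ M₀))) ∙ B
        ≡⟨ ≡.cong₂ _∙_ (≡.cong₂ _∙_ (sum-cong-≗ {n = d} λ j → ≡.cong (f (suc d)) (≡.trans
               (solve 3 (λ d j m → con 1 :+ (d :+ (con 1 :+ (j :+ m))) := con 1 :+ (j :+ (con 1 :+ (d :+ m)))) ≡.refl d (toℕ j) M₀)
               (≡.cong (λ t → suc (t ℕ.+ suc (d ℕ.+ M₀))) (≡.sym (toℕ-inject₁ j)))))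
             (≡.cong (f (suc d)) (≡.trans
               (solve 2 (λ d m → con 2 :+ (d :+ d :+ m) := con 1 :+ (d :+ (con 1 :+ (d :+ m)))) ≡.refl d M₀)
               (≡.cong (λ t → suc (t ℕ.+ suc (d ℕ.+ M₀))) (≡.sym (toℕ-fromℕ d))))))
             (sum-cong-≗ {n = k} λ j → ≡.cong (f (suc (suc d)))
               (solve 3 (λ d j m → con 1 :+ (con 1 :+ d :+ (con 2 :+ (d :+ j :+ m))) := con 2 :+ (con 1 :+ d :+ j :+ (con 1 :+ (d :+ m)))) ≡.refl d (toℕ j) M₀)) ⟩
      ∑ {d} (λ j → f (suc d) (suc (toℕ (inject₁ j) ℕ.+ suc (d ℕ.+ M₀)))) ∙
      f (suc d) (suc (toℕ (fromℕ d) ℕ.+ suc (d ℕ.+ M₀))) ∙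
      ∑ {k} (λ j → f (suc (suc d)) (suc (suc (suc d ℕ.+ toℕ j ℕ.+ suc (d ℕ.+ M₀)))))
        ≈⟨ ∙-congʳ (sum-init-last (λ j → f (suc d) (suc (toℕ j ℕ.+ suc (d ℕ.+ M₀))))) ⟨
      ∑ {suc d} (λ j → f (suc d) (suc (toℕ j ℕ.+ suc (d ℕ.+ M₀)))) ∙
      ∑ {k} (λ j → f (suc (suc d)) (suc (suc (suc d ℕ.+ toℕ j ℕ.+ suc (d ℕ.+ M₀)))))
        ∎
      where
      A = ∑ {d} (λ j → f (suc d) (suc (d ℕ.+ suc (toℕ j ℕ.+ M₀))))
      B = ∑ {k} (λ j → f (suc (suc d)) (suc (suc d ℕ.+ suc (suc (d ℕ.+ toℕ j ℕ.+ M₀)))))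
    -- Here that slot is the leftmost ascent: its term takes the index j = 0 in the second sum and
    -- shifts the other indices by one.
    ... | false = begin
      F ∙ (A ∙ B)
        ≈⟨ assoc _ _ _ ⟨
      F ∙ A ∙ B
        ≈⟨ ∙-congʳ (comm _ _) ⟩
      A ∙ F ∙ B
        ≈⟨ assoc _ _ _ ⟩
      A ∙ (F ∙ B)
        ≡⟨ ≡.cong₂ _∙_ (sum-cong-≗ {n = d} λ j → ≡.cong (f d)
               (solve 3 (λ d j m → d :+ (con 1 :+ (j :+ m)) := con 1 :+ (j :+ (d :+ m))) ≡.refl d (toℕ j) M₀))
             (≡.cong₂ _∙_ (≡.cong (f (suc d))
               (solve 2 (λ d m → con 2 :+ (d :+ d :+ m) := con 2 :+ (d :+ con 0 :+ (d :+ m))) ≡.refl d M₀))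
             (sum-cong-≗ {n = k} λ j → ≡.cong (f (suc d))
               (solve 3 (λ d j m → con 1 :+ d :+ (con 2 :+ (d :+ j :+ m)) := con 2 :+ (d :+ (con 1 :+ j) :+ (d :+ m))) ≡.refl d (toℕ j) M₀))) ⟩
      ∑ {d} (λ j → f d (suc (toℕ j ℕ.+ (d ℕ.+ M₀)))) ∙
      ∑ {suc k} (λ j → f (suc d) (suc (suc (d ℕ.+ toℕ j ℕ.+ (d ℕ.+ M₀)))))
        ∎
      where
      F = f (suc d) (suc (suc (d ℕ.+ d ℕ.+ M₀)))
      A = ∑ {d} (λ j → f d (d ℕ.+ suc (toℕ j ℕ.+ M₀)))
      B = ∑ {k} (λ j → f (suc d) (suc d ℕ.+ suc (suc (d ℕ.+ toℕ j ℕ.+ M₀))))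

-- Insertion as a bijection between permutations with slots and longer permutations.

lookup-injective⇒unique : ∀ {a} {A : Set a} {m} {xs : Vec A m} →
  (∀ {i j} → lookup xs i ≡ lookup xs j → i ≡ j) → Unique xs
lookup-injective⇒unique {xs = xs} inj = ≡.subst Unique (tabulate∘lookup xs) (VecUniqueₚ.tabulate⁺ inj)

raise≢top : ∀ {r} (a : Fin r) → raise a ≢ fromℕ r
raise≢top a = punchInᵢ≢i _ a

insertTop-unique : ∀ {r m} {σ : Vec (Fin r) m} p → Unique σ → Unique (insertTop σ p)
insertTop-unique {σ = σ} p u = lookup-injective⇒unique (inj _ _)
  where
  inj : ∀ i j → lookup (insertTop σ p) i ≡ lookup (insertTop σ p) j → i ≡ j
  inj i j eq with slotView p i | slotView p j
  ... | at     | at     = ≡.refl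
  ... | at     | away j′ rewrite lookup-insertTop σ p | lookup-insertTop-punchIn σ p j′ =
    contradiction (≡.sym eq) (raise≢top _)
  ... | away i′ | at     rewrite lookup-insertTop σ p | lookup-insertTop-punchIn σ p i′ =
    contradiction eq (raise≢top _)
  ... | away i′ | away j′ rewrite lookup-insertTop-punchIn σ p i′ | lookup-insertTop-punchIn σ p j′ =
    ≡.cong (punchIn p) (VecUniqueₚ.lookup-injective u i′ j′ (punchIn-injective _ _ _ eq))

-- All other letters are raised, so the place of the largest letter determines the slot; what
-- remains determines the word, because `raise` is injective.
insertTop-injective : ∀ {r m} {σ τ : Vec (Fin r) m} {p q} →
  insertTop σ p ≡ insertTop τ q → σ ≡ τ × p ≡ q
insertTop-injective {σ = σ} {τ} {p} {q} eq with slotView q p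
... | away i = contradiction
  (≡.trans (≡.sym (lookup-insertTop-punchIn τ q i))
    (≡.trans (≡.sym (≡.cong (flip lookup (punchIn q i)) eq)) (lookup-insertTop σ (punchIn q i))))
  (raise≢top _)
... | at = Pointwise-≡⇒≡ (ext λ i → punchIn-injective _ _ _
  (≡.trans (≡.sym (lookup-insertTop-punchIn σ p i))
    (≡.trans (≡.cong (flip lookup (punchIn p i)) eq) (lookup-insertTop-punchIn τ p i)))) , ≡.refl

-- Pigeonhole: if the largest letter were missing, `punchOut` would turn `lookup σ` into an
-- injection from `Fin (suc m)` to `Fin m`.
top∈ : ∀ {m} {σ : Vec (Fin (suc m)) (suc m)} → Unique σ → ∃ λ p → lookup σ p ≡ fromℕ m
top∈ {m} {σ} u with any? (λ p → lookup σ p ≟ fromℕ m)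
... | yes found = found
... | no  ¬found = contradiction
  (injective⇒≤ {f = λ i → punchOut (top≢ i)}
    (λ eq → VecUniqueₚ.lookup-injective u _ _ (punchOut-injective (top≢ _) (top≢ _) eq)))
  ℕₚ.1+n≰n
  where
  top≢ : ∀ i → fromℕ m ≢ lookup σ i
  top≢ i eq = ¬found (i , ≡.sym eq)

insertTop-surjective : ∀ {m} {σ : Vec (Fin (suc m)) (suc m)} → Unique σ →
  ∃₂ λ τ p → Unique τ × σ ≡ insertTop τ p
insertTop-surjective {m} {σ} u with p , σp≡top ← top∈ u =
  τ , p ,
  lookup-injective⇒unique τ-injective ,
  Pointwise-≡⇒≡ (ext σ≗)
  where
  top≢ : ∀ i → fromℕ m ≢ lookup σ (punchIn p i)
  top≢ i eq = punchInᵢ≢i p i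
    (VecUniqueₚ.lookup-injective u _ _ (≡.trans (≡.sym eq) (≡.sym σp≡top)))

  τ : Vec (Fin m) m
  τ = Vec.tabulate (λ i → punchOut (top≢ i))

  raise-τ : ∀ i → raise (lookup τ i) ≡ lookup σ (punchIn p i)
  raise-τ i = ≡.trans (≡.cong raise (lookup∘tabulate _ i)) (punchIn-punchOut (top≢ i))

  τ-injective : ∀ {i j} → lookup τ i ≡ lookup τ j → i ≡ j
  τ-injective {i} {j} eq = punchIn-injective p i j (VecUniqueₚ.lookup-injective u _ _
    (≡.trans (≡.sym (raise-τ i)) (≡.trans (≡.cong raise eq) (raise-τ j))))

  σ≗ : lookup σ ≗ lookup (insertTop τ p)
  σ≗ j with slotView p j
  ... | at     = ≡.trans σp≡top (≡.sym (lookup-insertTop τ p))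
  ... | away i = ≡.sym (≡.trans (lookup-insertTop-punchIn τ p i) (raise-τ i))

∈-permutations⁺ : ∀ {m} {σ : Vec (Fin m) m} → Unique σ → σ ∈ permutations m
∈-permutations⁺ {σ = σ} = ∈-filter⁺ unique? (∈-words σ)

∈-permutations⁻ : ∀ {m} {σ : Vec (Fin m) m} → σ ∈ permutations m → Unique σ
∈-permutations⁻ {m} = proj₂ ∘ ∈-filter⁻ unique? {xs = words m m}

permutations-unique : ∀ m → ListUnique.Unique (permutations m)
permutations-unique m = ListUniqueₚ.filter⁺ unique? (words-unique m m)

-- The two lists are ordered differently. Both are duplicate-free with the same members, and for
-- such lists equality as sets is equality as bags, hence a rearrangement.
permutations-suc : ∀ m →
  permutations (suc m) ↭ cartesianProductWith insertTop (permutations m) (allFin (suc m))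
permutations-suc m = ∼bag⇒↭ (unique∧set⇒bag
  (permutations-unique (suc m))
  (ListUniqueₚ.cartesianProductWith⁺ insertTop insertTop-injective
    (permutations-unique m) (ListUniqueₚ.allFin⁺ (suc m)))
  (mk⇔ to from))
  where
  to : ∀ {σ} → σ ∈ permutations (suc m) → σ ∈ cartesianProductWith insertTop (permutations m) (allFin (suc m))
  to σ∈ with τ , p , τ-unique , ≡.refl ← insertTop-surjective (∈-permutations⁻ σ∈) =
    ∈-cartesianProductWith⁺ insertTop (∈-permutations⁺ τ-unique) (∈-allFin p)

  from : ∀ {σ} → σ ∈ cartesianProductWith insertTop (permutations m) (allFin (suc m)) → σ ∈ permutations (suc m)
  from σ∈ with τ , p , τ∈ , _ , ≡.refl ←
      ∈-cartesianProductWith⁻ insertTop (permutations m) (allFin (suc m)) σ∈ =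
    ∈-permutations⁺ (insertTop-unique p (∈-permutations⁻ τ∈))

-- Sums over lists with values in `K`.

module _ {c ℓ} (K : CommutativeRing c ℓ) where

  open CommutativeRing K
  open SetoidReasoning setoid

  -- Makes the condition on the number of descents a factor of the summand: insertion can change
  -- that number, so the sum has to run over all permutations.
  χ : ∀ {p} {P : Set p} → Dec P → Carrier
  χ P? = if does P? then 1# else 0#

  χ-gate : ∀ {p} {P : Set p} (P? : Dec P) {x y} → (P → x ≈ y) → χ P? * x ≈ χ P? * y
  χ-gate (yes p) x≈y = *-congˡ (x≈y p)
  χ-gate (no ¬p) x≈y = trans (zeroˡ _) (sym (zeroˡ _))

module _ {x ℓx c ℓ} (X : CommutativeRing x ℓx) (K : CommutativeRing c ℓ) (Q : QPower X K) where

  open CommutativeRing K hiding (zero)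
  open QPower Q
  open SetoidReasoning setoid
  open SemiringSum semiring using (*-distribˡ-sum)
  open MonoidSum +-commutativeMonoid using (sum; sum-cong-≋; sum-cong-≗; sum-init-last)
  open NaturalSolver commutativeSemiring using (solve; _:=_; _:+_; _:*_; con)
  private
    module X = CommutativeRing X
    module XMult = SemiringMult X.semiring
    module XSolver = NaturalSolver X.commutativeSemiring
    module Hom = MonoidMorphisms.IsMonoidHomomorphism isMonoidHomomorphism

  ∑-cong : ∀ {a} {A : Set a} (xs : List A) {f g : A → Carrier} →
    (∀ x → f x ≈ g x) → ∑ xs f ≈ ∑ xs g
  ∑-cong []       f≈g = refl
  ∑-cong (x ∷ xs) f≈g = +-cong (f≈g x) (∑-cong xs f≈g)

  ∑-distrib-+ : ∀ {a} {A : Set a} (xs : List A) (f g : A → Carrier) →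
    ∑ xs (λ x → f x + g x) ≈ ∑ xs f + ∑ xs g
  ∑-distrib-+ []       f g = sym (+-identityˡ 0#)
  ∑-distrib-+ (x ∷ xs) f g = trans (+-congˡ (∑-distrib-+ xs f g))
    (solve 4 (λ a b c d → (a :+ b) :+ (c :+ d) := (a :+ c) :+ (b :+ d)) refl _ _ _ _)

  *-distribˡ-∑ : ∀ {a} {A : Set a} (xs : List A) (y : Carrier) (f : A → Carrier) →
    y * ∑ xs f ≈ ∑ xs (λ x → y * f x)
  *-distribˡ-∑ []       y f = zeroʳ y
  *-distribˡ-∑ (x ∷ xs) y f = trans (distribˡ y _ _) (+-congˡ (*-distribˡ-∑ xs y f))

  ∑-++ : ∀ {a} {A : Set a} (xs ys : List A) (f : A → Carrier) → ∑ (xs ++ ys) f ≈ ∑ xs f + ∑ ys f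
  ∑-++ []       ys f = sym (+-identityˡ _)
  ∑-++ (x ∷ xs) ys f = trans (+-congˡ (∑-++ xs ys f)) (sym (+-assoc _ _ _))

  ∑-map : ∀ {a b} {A : Set a} {B : Set b} (xs : List A) (g : A → B) (f : B → Carrier) →
    ∑ (map g xs) f ≡ ∑ xs (f ∘ g)
  ∑-map []       g f = ≡.refl
  ∑-map (x ∷ xs) g f = ≡.cong (f (g x) +_) (∑-map xs g f)

  ∑-cartesianProductWith : ∀ {a b d} {A : Set a} {B : Set b} {D : Set d}
    (g : A → B → D) (xs : List A) (ys : List B) (f : D → Carrier) →
    ∑ (cartesianProductWith g xs ys) f ≈ ∑ xs (λ x → ∑ ys (f ∘ g x))
  ∑-cartesianProductWith g []       ys f = refl
  ∑-cartesianProductWith g (x ∷ xs) ys f = trans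
    (∑-++ (map (g x) ys) _ f)
    (+-cong (reflexive (∑-map ys (g x) f)) (∑-cartesianProductWith g xs ys f))

  ∑-tabulate : ∀ {a} {A : Set a} {n} (g : Fin n → A) (f : A → Carrier) →
    ∑ (List.tabulate g) f ≡ sum (f ∘ g)
  ∑-tabulate {n = zero}  g f = ≡.refl
  ∑-tabulate {n = suc n} g f = ≡.cong (f (g zero) +_) (∑-tabulate (g ∘ suc) f)

  ∑-filter : ∀ {a p} {A : Set a} {P : Pred A p} (P? : Decidable₁ P) (xs : List A) (f : A → Carrier) →
    ∑ (filter P? xs) f ≈ ∑ xs (λ x → χ K (P? x) * f x)
  ∑-filter P? []       f = refl
  ∑-filter P? (x ∷ xs) f with ih ← ∑-filter P? xs f | P? x
  ... | yes _ = +-cong (sym (*-identityˡ _)) ih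
  ... | no  _ = trans ih (sym (trans (+-congʳ (zeroˡ _)) (+-identityˡ _)))

  ∑-↭ : ∀ {a} {A : Set a} {xs ys : List A} (f : A → Carrier) → xs ↭ ys → ∑ xs f ≈ ∑ ys f
  ∑-↭ f _↭_.refl          = refl
  ∑-↭ f (_↭_.prep x p)    = +-congˡ (∑-↭ f p)
  ∑-↭ f (_↭_.swap x y p)  = trans (+-congˡ (+-congˡ (∑-↭ f p)))
    (solve 3 (λ a b c → a :+ (b :+ c) := b :+ (a :+ c)) refl _ _ _)
  ∑-↭ f (_↭_.trans p₁ p₂) = trans (∑-↭ f p₁) (∑-↭ f p₂)

  -- The q-numbers `[ x ]`.

  []-cong : ∀ {x y} → x X.≈ y → [ x ] ≈ [ y ]
  []-cong x≈y = *-congʳ (+-congˡ (-‿cong (Hom.⟦⟧-cong x≈y)))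

  -- From 1 - q·q^x = (1 - q^x) + q^x (1 - q), divided by 1 - q.
  [1+x] : ∀ x → [ X.1# X.+ x ] ≈ [ x ] + q^ x
  [1+x] x = begin
    (1# - q^ (X.1# X.+ x)) * [1-q]⁻¹
      ≈⟨ *-congʳ (+-congˡ (-‿cong (Hom.homo X.1# x))) ⟩
    (1# - q * q^ x) * [1-q]⁻¹
      ≈⟨ *-congʳ split ⟩
    ((1# - q^ x) + q^ x * (1# - q)) * [1-q]⁻¹
      ≈⟨ solve 4 (λ a y b i → (a :+ y :* b) :* i := a :* i :+ y :* (b :* i)) refl (1# - q^ x) (q^ x) (1# - q) [1-q]⁻¹ ⟩
    [ x ] + q^ x * ((1# - q) * [1-q]⁻¹)
      ≈⟨ +-congˡ (trans (*-congˡ [1-q]-inv) (*-identityʳ _)) ⟩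
    [ x ] + q^ x
      ∎
    where
    open RingProperties ring using (-‿distribʳ-*)

    split : 1# - q * q^ x ≈ (1# - q^ x) + q^ x * (1# - q)
    split = sym (begin
      (1# - q^ x) + q^ x * (1# - q)
        -- The solver handles semirings only, so `- q^ x` and `- q` enter as atoms; the cancellation
        -- follows in the next step.
        ≈⟨ solve 4 (λ y n m o → (o :+ n) :+ y :* (o :+ m) := (o :+ y :* m) :+ (n :+ y :* o)) refl (q^ x) (- q^ x) (- q) 1# ⟩
      (1# + q^ x * - q) + (- q^ x + q^ x * 1#)
        ≈⟨ +-cong (+-congˡ (trans (sym (-‿distribʳ-* _ _)) (-‿cong (*-comm _ _))))
                  (trans (+-congˡ (*-identityʳ _)) (-‿inverseˡ _)) ⟩
      (1# - q * q^ x) + 0#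
        ≈⟨ +-identityʳ _ ⟩
      1# - q * q^ x
        ∎)

  -- Each application of `[1+x]` absorbs the first remaining power into the q-number and replaces
  -- `x` by `1 + x`, so the induction needs `x` general.
  [ι+x] : ∀ a x → [ x ] + sum {a} (λ j → q^ (x X.+ ι (toℕ j))) ≈ [ ι a X.+ x ]
  [ι+x] zero    x = trans (+-identityʳ _) ([]-cong (X.sym (X.+-identityˡ x)))
  [ι+x] (suc a) x = begin
    [ x ] + (q^ (x X.+ X.0#) + sum {a} (λ j → q^ (x X.+ ι (suc (toℕ j)))))
      ≈⟨ +-assoc _ _ _ ⟨
    [ x ] + q^ (x X.+ X.0#) + sum {a} (λ j → q^ (x X.+ ι (suc (toℕ j))))
      ≈⟨ +-cong (+-congˡ (Hom.⟦⟧-cong (X.+-identityʳ x)))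
                (sum-cong-≋ {a} (λ j → Hom.⟦⟧-cong (shift (ι (toℕ j))))) ⟩
    [ x ] + q^ x + sum {a} (λ j → q^ ((X.1# X.+ x) X.+ ι (toℕ j)))
      ≈⟨ +-congʳ ([1+x] x) ⟨
    [ X.1# X.+ x ] + sum {a} (λ j → q^ ((X.1# X.+ x) X.+ ι (toℕ j)))
      ≈⟨ [ι+x] a (X.1# X.+ x) ⟩
    [ ι a X.+ (X.1# X.+ x) ]
      ≈⟨ []-cong (X.trans (X.sym (X.+-assoc _ _ _)) (X.+-congʳ (X.+-comm _ _))) ⟩
    [ ι (suc a) X.+ x ]
      ∎
    where
    shift : ∀ t → x X.+ (X.1# X.+ t) X.≈ (X.1# X.+ x) X.+ t
    shift t = X.trans (X.sym (X.+-assoc _ _ _)) (X.+-congʳ (X.+-comm _ _))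

  ι-+ : ∀ m n → ι (m ℕ.+ n) X.≈ ι m X.+ ι n
  ι-+ = XMult.×-homo-+ X.1#

  ι-∸ : ∀ m n → ι (m ℕ.+ n) X.- ι m X.≈ ι n
  ι-∸ m n = X.trans (X.+-congʳ (ι-+ m n))
    (AbelianGroupProperties.xyx⁻¹≈y X.+-abelianGroup (ι m) (ι n))

  -- The exponent of q under insertion.

  module _ (α β : X.Carrier) where

    -- maj~ α β σ is definitionally exponent (des σ) (lrmin σ) (rlmin σ) (suc n) (maj σ).
    exponent : (d l r n m : ℕ) → X.Carrier
    exponent d l r n m =
      (X.1# X.+ ι d X.- ι l) X.* (α X.- X.1#) X.+ (ι n X.- ι r) X.* (β X.- X.1#) X.+ ι m

    private
      -1ₓ : X.Carrier
      -1ₓ = X.- X.1#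

      -ι-suc : ∀ l → X.- ι (suc l) X.≈ -1ₓ X.+ X.- ι l
      -ι-suc l = X.sym (AbelianGroupProperties.⁻¹-∙-comm X.+-abelianGroup X.1# (ι l))

      -- The semiring solver treats -1ₓ as an atom, so each identity below is first
      -- proved up to a multiple of 1 + (−1).
      absorb : ∀ y z → y X.+ (X.1# X.+ -1ₓ) X.* z X.≈ y
      absorb y z = X.trans
        (X.+-congˡ (X.trans (X.*-congʳ (X.-‿inverseʳ X.1#)) (X.zeroˡ z)))
        (X.+-identityʳ y)

      open XSolver using () renaming (solve to solveₓ; _:=_ to _:=ₓ_; _:+_ to _⊕_; _:*_ to _⊗_; con to conₓ)

    module _ (d l r n m : ℕ) where

      private
        e = exponent d l r n m

      -- Length and `rlmin` both rise by one; their changes leave (1 + (-1))(β - 1), which `absorb`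
      -- removes.
      exponent-last : exponent d l (suc r) (suc n) m X.≈ e
      exponent-last = X.trans
        (X.+-congʳ (X.+-congˡ (X.*-congʳ (X.+-congˡ (-ι-suc r)))))
        (X.trans
          (solveₓ 8 (λ a b i d l r n m →
              (conₓ 1 ⊕ d ⊕ l) ⊗ (a ⊕ i) ⊕ (conₓ 1 ⊕ n ⊕ (i ⊕ r)) ⊗ (b ⊕ i) ⊕ m :=ₓ
              ((conₓ 1 ⊕ d ⊕ l) ⊗ (a ⊕ i) ⊕ (n ⊕ r) ⊗ (b ⊕ i) ⊕ m) ⊕ (conₓ 1 ⊕ i) ⊗ (b ⊕ i))
            X.refl α β -1ₓ (ι d) (X.- ι l) (X.- ι r) (ι n) (ι m))
          (absorb e (β X.+ -1ₓ)))

      -- The length contributes β - 1 and `maj` contributes 1 + j.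
      exponent-descent : ∀ j →
        exponent d l r (suc n) (suc (j ℕ.+ m)) X.≈ e X.+ (β X.+ ι j)
      exponent-descent j = X.trans
        (X.+-congˡ (X.+-congˡ (ι-+ j m)))
        (X.trans
          (solveₓ 9 (λ a b i d l r n m j →
              (conₓ 1 ⊕ d ⊕ l) ⊗ (a ⊕ i) ⊕ (conₓ 1 ⊕ n ⊕ r) ⊗ (b ⊕ i) ⊕ (conₓ 1 ⊕ (j ⊕ m)) :=ₓ
              (((conₓ 1 ⊕ d ⊕ l) ⊗ (a ⊕ i) ⊕ (n ⊕ r) ⊗ (b ⊕ i) ⊕ m) ⊕ (b ⊕ j)) ⊕ (conₓ 1 ⊕ i) ⊗ conₓ 1)
            X.refl α β -1ₓ (ι d) (X.- ι l) (X.- ι r) (ι n) (ι m) (ι j))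
          (absorb (e X.+ (β X.+ ι j)) X.1#))

      -- The rises of `des` and `lrmin` cancel; the length contributes β - 1 and `maj` contributes d
      -- + 1.
      exponent-first : exponent (suc d) (suc l) r (suc n) (suc (d ℕ.+ m)) X.≈
                       e X.+ (β X.+ ι (suc d) X.- X.1#)
      exponent-first = X.trans
        (X.+-cong (X.+-congʳ (X.*-congʳ (X.+-congˡ (-ι-suc l)))) (X.+-congˡ (ι-+ d m)))
        (X.trans
          (solveₓ 8 (λ a b i d l r n m →
              (conₓ 1 ⊕ (conₓ 1 ⊕ d) ⊕ (i ⊕ l)) ⊗ (a ⊕ i) ⊕ (conₓ 1 ⊕ n ⊕ r) ⊗ (b ⊕ i) ⊕ (conₓ 1 ⊕ (d ⊕ m)) :=ₓ
              (((conₓ 1 ⊕ d ⊕ l) ⊗ (a ⊕ i) ⊕ (n ⊕ r) ⊗ (b ⊕ i) ⊕ m) ⊕ (b ⊕ (conₓ 1 ⊕ d) ⊕ i)) ⊕ (conₓ 1 ⊕ i) ⊗ (a ⊕ i))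
            X.refl α β -1ₓ (ι d) (X.- ι l) (X.- ι r) (ι n) (ι m))
          (absorb (e X.+ (β X.+ ι (suc d) X.- X.1#)) (α X.+ -1ₓ)))

      -- `des` rises without `lrmin` and contributes α - 1, the length contributes β - 1, and `maj`
      -- contributes d + j + 2.
      exponent-ascent : ∀ j →
        exponent (suc d) l r (suc n) (suc (suc (d ℕ.+ j ℕ.+ m))) X.≈
        e X.+ ((β X.+ ι (suc d) X.- X.1#) X.+ (α X.+ ι j))
      exponent-ascent j = X.trans
        (X.+-congˡ (X.+-congˡ (X.+-congˡ (X.trans (ι-+ (d ℕ.+ j) m) (X.+-congʳ (ι-+ d j))))))
        (X.trans
          (solveₓ 9 (λ a b i d l r n m j →
              (conₓ 1 ⊕ (conₓ 1 ⊕ d) ⊕ l) ⊗ (a ⊕ i) ⊕ (conₓ 1 ⊕ n ⊕ r) ⊗ (b ⊕ i) ⊕ (conₓ 1 ⊕ (conₓ 1 ⊕ (d ⊕ j ⊕ m))) :=ₓ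
              (((conₓ 1 ⊕ d ⊕ l) ⊗ (a ⊕ i) ⊕ (n ⊕ r) ⊗ (b ⊕ i) ⊕ m) ⊕ ((b ⊕ (conₓ 1 ⊕ d) ⊕ i) ⊕ (a ⊕ j))) ⊕ (conₓ 1 ⊕ i) ⊗ conₓ 1)
            X.refl α β -1ₓ (ι d) (X.- ι l) (X.- ι r) (ι n) (ι m) (ι j))
          (absorb (e X.+ ((β X.+ ι (suc d) X.- X.1#) X.+ (α X.+ ι j))) X.1#))

    -- Summing the weight over all slots of one permutation.

    weight : ∀ {n} → Vec (Fin (suc n)) (suc n) → Carrier
    weight σ = [ α ] ^ (lrmin σ ∸ 1) * [ β ] ^ (rlmin σ ∸ 1) * q^ (maj~ α β σ)

    -- Applied with `lrmin-positive` and `rlmin-positive`, so the subtraction of 1 in `weight` is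
    -- never truncated.
    ^-∸1 : ∀ y {l} → 0 ℕ.< l → y ^ l ≈ y * y ^ (l ∸ 1)
    ^-∸1 y {suc l} _ = refl

    -- This is q^(β+d), spelled as in the recurrence for `E` at `suc d`, so that the two agree by
    -- definition.
    leading : ℕ → Carrier
    leading d = q^ (β X.+ ι (suc d) X.- X.1#)

    -- `g` is later the indicator that the new word has k descents; while it is arbitrary, the cases
    -- of insertion need no split on k.
    module _ {n} (τ : Vec (Fin (suc n)) (suc n)) (g : ℕ → Carrier) where

      private
        d = des τ
        a = asc τ
        l = lrmin τ
        r = rlmin τ
        m = maj τ
        e = maj~ α β τ
        A = [ α ] ^ (l ∸ 1)
        B = [ β ] ^ (r ∸ 1)

        term : Fin (suc (suc n)) → Carrier
        term p = g (des (insertTop τ p)) * weight (insertTop τ p)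

        inner : ℕ → ℕ → Carrier
        inner d′ m′ = g d′ * (A * B * q^ exponent d′ l r (suc (suc n)) m′)

      term-first : term zero ≈ (g (suc d) * weight τ) * leading d * [ α ]
      term-first
        -- The front slot `zero` is also `inject₁ zero`, so it is not the end slot and `rlmin` is
        -- unchanged.
        rewrite des-insertTop-zero τ | maj-insertTop-zero τ | lrmin-insertTop-zero τ
              | rlmin-insertTop-inject₁ τ zero = begin
        g (suc d) * ([ α ] ^ l * B * q^ exponent (suc d) (suc l) r (suc (suc n)) (suc (d ℕ.+ m)))
          ≈⟨ *-congˡ (*-cong (*-congʳ (^-∸1 [ α ] (lrmin-positive τ)))
               (trans (Hom.⟦⟧-cong (exponent-first d l r (suc n) m)) (Hom.homo e _))) ⟩
        g (suc d) * (([ α ] * A) * B * (q^ e * leading d))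
          ≈⟨ solve 6 (λ g x a b w c → g :* ((x :* a) :* b :* (w :* c)) := (g :* (a :* b :* w)) :* c :* x)
               refl (g (suc d)) [ α ] A B (q^ e) (leading d) ⟩
        (g (suc d) * weight τ) * leading d * [ α ]
          ∎

      term-last : term (fromℕ (suc n)) ≈ (g d * weight τ) * [ β ]
      term-last
        rewrite des-insertTop-top τ | maj-insertTop-top τ | lrmin-insertTop-suc τ (fromℕ n)
              | rlmin-insertTop-top τ = begin
        g d * (A * [ β ] ^ r * q^ exponent d l (suc r) (suc (suc n)) m)
          ≈⟨ *-congˡ (*-cong (*-congˡ (^-∸1 [ β ] (rlmin-positive τ)))
               (Hom.⟦⟧-cong (exponent-last d l r (suc n) m))) ⟩
        g d * (A * ([ β ] * B) * q^ e)
          ≈⟨ solve 5 (λ g x a b w → g :* (a :* (x :* b) :* w) := (g :* (a :* b :* w)) :* x)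
               refl (g d) [ β ] A B (q^ e) ⟩
        (g d * weight τ) * [ β ]
          ∎

      -- An inner slot is both a `suc` and an `inject₁`, so neither number of minima changes and
      -- only `des` and `maj` vary.
      term-inner : ∀ i → term (suc (inject₁ i)) ≡
        inner (des (insertTop τ (suc (inject₁ i)))) (maj (insertTop τ (suc (inject₁ i))))
      term-inner i
        rewrite lrmin-insertTop-suc τ (inject₁ i) | rlmin-insertTop-inject₁ τ (suc i) = ≡.refl

      inner-descent : ∀ j → inner d (suc (j ℕ.+ m)) ≈ (g d * weight τ) * q^ (β X.+ ι j)
      inner-descent j = begin
        g d * (A * B * q^ exponent d l r (suc (suc n)) (suc (j ℕ.+ m)))
          ≈⟨ *-congˡ (*-congˡ (trans (Hom.⟦⟧-cong (exponent-descent d l r (suc n) m j)) (Hom.homo e _))) ⟩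
        g d * (A * B * (q^ e * q^ (β X.+ ι j)))
          ≈⟨ solve 4 (λ g a w c → g :* (a :* (w :* c)) := (g :* (a :* w)) :* c) refl (g d) (A * B) (q^ e) _ ⟩
        (g d * weight τ) * q^ (β X.+ ι j)
          ∎

      inner-ascent : ∀ j → inner (suc d) (suc (suc (d ℕ.+ j ℕ.+ m))) ≈
        (g (suc d) * weight τ) * leading d * q^ (α X.+ ι j)
      inner-ascent j = begin
        g (suc d) * (A * B * q^ exponent (suc d) l r (suc (suc n)) (suc (suc (d ℕ.+ j ℕ.+ m))))
          ≈⟨ *-congˡ (*-congˡ (trans (Hom.⟦⟧-cong (exponent-ascent d l r (suc n) m j))
               (trans (Hom.homo e _) (*-congˡ (Hom.homo _ _))))) ⟩
        g (suc d) * (A * B * (q^ e * (leading d * q^ (α X.+ ι j))))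
          ≈⟨ solve 5 (λ g a w c y → g :* (a :* (w :* (c :* y))) := (g :* (a :* w)) :* c :* y)
               refl (g (suc d)) (A * B) (q^ e) (leading d) _ ⟩
        (g (suc d) * weight τ) * leading d * q^ (α X.+ ι j)
          ∎

      ∑-insertTop :
        ∑ (allFin (suc (suc n))) (λ p → g (des (insertTop τ p)) * weight (insertTop τ p)) ≈
        g (suc d) * weight τ * (leading d * [ ι a X.+ α ]) + g d * weight τ * [ ι d X.+ β ]
      ∑-insertTop = begin
        ∑ (allFin (suc (suc n))) term
          ≡⟨ ∑-tabulate {n = suc (suc n)} id term ⟩
        term zero + sum (λ p → term (suc p))
          ≈⟨ +-congˡ (sum-init-last (λ p → term (suc p))) ⟩
        term zero + (sum (λ i → term (suc (inject₁ i))) + term (fromℕ (suc n)))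
          ≈⟨ +-cong term-first (+-cong inner-sum term-last) ⟩
        u * [ α ] + ((v * sum {d} (λ j → q^ (β X.+ ι (toℕ j))) + u * sum {a} (λ j → q^ (α X.+ ι (toℕ j)))) + v * [ β ])
          ≈⟨ solve 6 (λ u v a b s t → u :* a :+ ((v :* s :+ u :* t) :+ v :* b) := u :* (a :+ t) :+ v :* (b :+ s))
               refl u v [ α ] [ β ] _ _ ⟩
        u * ([ α ] + sum {a} (λ j → q^ (α X.+ ι (toℕ j)))) + v * ([ β ] + sum {d} (λ j → q^ (β X.+ ι (toℕ j))))
          ≈⟨ +-cong (*-congˡ ([ι+x] a α)) (*-congˡ ([ι+x] d β)) ⟩
        u * [ ι a X.+ α ] + v * [ ι d X.+ β ]
          ≈⟨ +-congʳ (*-assoc (g (suc d) * weight τ) (leading d) _) ⟩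
        g (suc d) * weight τ * (leading d * [ ι a X.+ α ]) + v * [ ι d X.+ β ]
          ∎
        where
        u = (g (suc d) * weight τ) * leading d
        v = g d * weight τ

        inner-sum : sum (λ i → term (suc (inject₁ i))) ≈
          v * sum {d} (λ j → q^ (β X.+ ι (toℕ j))) + u * sum {a} (λ j → q^ (α X.+ ι (toℕ j)))
        inner-sum = begin
          sum (λ i → term (suc (inject₁ i)))
            ≡⟨ sum-cong-≗ term-inner ⟩
          sum (λ i → inner (des (insertTop τ (suc (inject₁ i)))) (maj (insertTop τ (suc (inject₁ i)))))
            ≈⟨ ∑-insertTop-inner +-commutativeMonoid τ inner ⟩
          sum {d} (λ j → inner d (suc (toℕ j ℕ.+ m))) +
          sum {a} (λ j → inner (suc d) (suc (suc (d ℕ.+ toℕ j ℕ.+ m))))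
            ≈⟨ +-cong (sum-cong-≋ {d} (λ j → inner-descent (toℕ j))) (sum-cong-≋ {a} (λ j → inner-ascent (toℕ j))) ⟩
          sum {d} (λ j → v * q^ (β X.+ ι (toℕ j))) + sum {a} (λ j → u * q^ (α X.+ ι (toℕ j)))
            ≈⟨ +-cong (*-distribˡ-sum {d} v _) (*-distribˡ-sum {a} u _) ⟨
          v * sum {d} (λ j → q^ (β X.+ ι (toℕ j))) + u * sum {a} (λ j → q^ (α X.+ ι (toℕ j)))
            ∎

    -- The recurrence for the sums over `𝔖` and the induction.

    ∑-𝔖-suc : ∀ n k → ∑ (𝔖 (suc n) k) weight ≈
      ∑ (permutations (suc n)) (λ τ →
        χ K (suc (des τ) ℕₚ.≟ k) * weight τ * (leading (des τ) * [ ι (asc τ) X.+ α ])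
        + χ K (des τ ℕₚ.≟ k) * weight τ * [ ι (des τ) X.+ β ])
    ∑-𝔖-suc n k = begin
      ∑ (𝔖 (suc n) k) weight
        ≈⟨ ∑-filter (λ σ → des σ ℕₚ.≟ k) (permutations (suc (suc n))) weight ⟩
      ∑ (permutations (suc (suc n))) restricted
        ≈⟨ ∑-↭ restricted (permutations-suc (suc n)) ⟩
      ∑ (cartesianProductWith insertTop (permutations (suc n)) (allFin (suc (suc n)))) restricted
        ≈⟨ ∑-cartesianProductWith insertTop (permutations (suc n)) (allFin (suc (suc n))) restricted ⟩
      ∑ (permutations (suc n)) (λ τ → ∑ (allFin (suc (suc n))) (λ p → restricted (insertTop τ p)))
        ≈⟨ ∑-cong (permutations (suc n)) (λ τ → ∑-insertTop τ (λ d → χ K (d ℕₚ.≟ k))) ⟩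
      _ ∎
      where
      restricted : Vec (Fin (suc (suc n))) (suc (suc n)) → Carrier
      restricted σ = χ K (des σ ℕₚ.≟ k) * weight σ

    -- The indicator annihilates every τ on which `C τ` may differ from `C₀`, so the coefficient can
    -- be pulled out as a constant.
    ∑-gate : ∀ n k (C : Vec (Fin (suc n)) (suc n) → Carrier) {C₀} →
      (∀ τ → des τ ≡ k → C τ ≈ C₀) →
      ∑ (permutations (suc n)) (λ τ → χ K (des τ ℕₚ.≟ k) * weight τ * C τ) ≈ C₀ * ∑ (𝔖 n k) weight
    ∑-gate n k C {C₀} C≈C₀ = begin
      ∑ (permutations (suc n)) (λ τ → χ K (des τ ℕₚ.≟ k) * weight τ * C τ)
        ≈⟨ ∑-cong (permutations (suc n)) summand ⟩
      ∑ (permutations (suc n)) (λ τ → C₀ * (χ K (des τ ℕₚ.≟ k) * weight τ))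
        ≈⟨ *-distribˡ-∑ (permutations (suc n)) C₀ _ ⟨
      C₀ * ∑ (permutations (suc n)) (λ τ → χ K (des τ ℕₚ.≟ k) * weight τ)
        ≈⟨ *-congˡ (∑-filter (λ τ → des τ ℕₚ.≟ k) (permutations (suc n)) weight) ⟨
      C₀ * ∑ (𝔖 n k) weight
        ∎
      where
      summand : ∀ τ → χ K (des τ ℕₚ.≟ k) * weight τ * C τ ≈ C₀ * (χ K (des τ ℕₚ.≟ k) * weight τ)
      summand τ = begin
        b * weight τ * C τ   ≈⟨ solve 3 (λ b w x → b :* w :* x := (b :* x) :* w) refl b (weight τ) (C τ) ⟩
        b * C τ * weight τ   ≈⟨ *-congʳ (χ-gate K (des τ ℕₚ.≟ k) (C≈C₀ τ)) ⟩
        b * C₀ * weight τ    ≈⟨ solve 3 (λ b x w → b :* x :* w := x :* (b :* w)) refl b C₀ (weight τ) ⟩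
        C₀ * (b * weight τ)  ∎
        where b = χ K (des τ ℕₚ.≟ k)

    -- By `des+asc` the number of ascents is n - k, which the recurrence for `E` writes as a
    -- difference of successors.
    ι-asc : ∀ {n k} (τ : Vec (Fin (suc n)) (suc n)) → des τ ≡ k →
      ι (asc τ) X.≈ ι (suc n) X.- ι (suc k)
    ι-asc τ ≡.refl = X.sym
      (≡.subst (λ t → ι (suc t) X.- ι (suc (des τ)) X.≈ ι (asc τ)) (des+asc τ) (ι-∸ (suc (des τ)) (asc τ)))

    ascent-factor : ∀ {n k} (τ : Vec (Fin (suc n)) (suc n)) → des τ ≡ k →
      leading (des τ) * [ ι (asc τ) X.+ α ] ≈ leading k * [ ι (suc n) X.- ι (suc k) X.+ α ]
    ascent-factor τ d≡k = *-cong (reflexive (≡.cong leading d≡k)) ([]-cong (X.+-congʳ (ι-asc τ d≡k)))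

    descent-factor : ∀ {n k} (τ : Vec (Fin (suc n)) (suc n)) → des τ ≡ k →
      [ ι (des τ) X.+ β ] ≈ [ ι k X.+ β ]
    descent-factor τ d≡k = reflexive (≡.cong (λ t → [ ι t X.+ β ]) d≡k)

    E-∑-𝔖 : ∀ n k → E α β n k ≈ ∑ (𝔖 n k) weight
    E-∑-𝔖 zero zero = sym (begin
      1# * 1# * q^ exponent 0 1 1 1 0 + 0#
        ≈⟨ +-identityʳ _ ⟩
      1# * 1# * q^ exponent 0 1 1 1 0
        ≈⟨ *-cong (*-identityˡ 1#) (trans (Hom.⟦⟧-cong vanish) Hom.ε-homo) ⟩
      1# * 1#
        ≈⟨ *-identityˡ 1# ⟩
      1#
        ∎)
      where
      -- For the one-letter word `lrmin`, `rlmin` and the length are all 1, so both differences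
      -- vanish.
      vanish : exponent 0 1 1 1 0 X.≈ X.0#
      vanish = X.trans (X.+-identityʳ _) (X.trans
        (X.+-cong (X.trans (X.*-congʳ (X.-‿inverseʳ (ι 1))) (X.zeroˡ _))
                  (X.trans (X.*-congʳ (X.-‿inverseʳ (ι 1))) (X.zeroˡ _)))
        (X.+-identityʳ X.0#))
    -- The one-letter word has no descent, so `𝔖 0 (suc k)` evaluates to the empty list.
    E-∑-𝔖 zero (suc k) = refl
    E-∑-𝔖 (suc n) zero = begin
      [ ι 0 X.+ β ] * E α β n 0
        ≈⟨ *-congˡ (E-∑-𝔖 n 0) ⟩
      [ ι 0 X.+ β ] * ∑ (𝔖 n 0) weight
        ≈⟨ ∑-gate n 0 (λ τ → [ ι (des τ) X.+ β ]) descent-factor ⟨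
      ∑ (permutations (suc n)) (λ τ → χ K (des τ ℕₚ.≟ 0) * weight τ * [ ι (des τ) X.+ β ])
        -- The indicator of `suc (des τ) ≡ 0` evaluates to `0#`: front and ascent insertions never
        -- give a word without descents.
        ≈⟨ ∑-cong (permutations (suc n)) (λ τ → trans
             (+-congʳ (trans (*-congʳ (zeroˡ _)) (zeroˡ _)))
             (+-identityˡ _)) ⟨
      _
        ≈⟨ ∑-𝔖-suc n 0 ⟨
      ∑ (𝔖 (suc n) 0) weight
        ∎
    E-∑-𝔖 (suc n) (suc k) = begin
      E α β (suc n) (suc k)
        ≈⟨ +-cong (*-congˡ (E-∑-𝔖 n k)) (*-congˡ (E-∑-𝔖 n (suc k))) ⟩
      leading k * [ ι (suc n) X.- ι (suc k) X.+ α ] * ∑ (𝔖 n k) weight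
      + [ ι (suc k) X.+ β ] * ∑ (𝔖 n (suc k)) weight
        -- `χ` looks only at `does`, so the indicators of `suc (des τ) ≡ suc k` and of `des τ ≡ k`
        -- agree by evaluation.
        ≈⟨ +-cong (∑-gate n k (λ τ → leading (des τ) * [ ι (asc τ) X.+ α ]) ascent-factor)
                  (∑-gate n (suc k) (λ τ → [ ι (des τ) X.+ β ]) descent-factor) ⟨
      _
        ≈⟨ ∑-distrib-+ (permutations (suc n)) _ _ ⟨
      _
        ≈⟨ ∑-𝔖-suc n (suc k) ⟨
      ∑ (𝔖 (suc n) (suc k)) weight
        ∎

theorem1p1 :
  ∀ {x ℓx c ℓ} (X : CommutativeRing x ℓx) (K : CommutativeRing c ℓ) (Q : QPower X K)
    (α β : CommutativeRing.Carrier X) (n k : ℕ) → k ≤ n →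
    let open CommutativeRing K
        open QPower Q
    in E α β n k ≈
       ∑ (𝔖 n k) (λ σ →
         [ α ] ^ (lrmin σ ∸ 1) * [ β ] ^ (rlmin σ ∸ 1) * q^ (maj~ α β σ))
theorem1p1 X K Q α β n k _ = E-∑-𝔖 X K Q α β n k
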